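{- Let $A$ be a finite set, $M$ a commutative monoid, and $\phi:A^*\to M$ a monoid homomorphism that is infinite-dimensional. Then the revital $Cons^\phi(A)$ is not finitely generated, i.e. there is no finite set $P\subseteq B(A)$ with $\lceil P\rceil=Cons^\phi(A)$.
   Context: For a finite set $A$ and a positive integer $n$, $B_n(A)=\mathrm{Sym}(A^n)$ is the group of bijections $A^n\to A^n$ and $B(A)=\bigcup_n B_n(A)$; its elements are called gates. For $\alpha\in S_n$, the wire permutation is $\pi_\alpha(x_1,\dots,x_n)=(x_{\alpha^{ -1}(1)},\dots,x_{\alpha^{ -1}(n)})$; a rewiring of $f\in B_n(A)$ is $\pi_\alpha\circ f\circ\pi_\alpha^{ -1}$ for some $\alpha\in S_n$. For $f\in B_n(A)$, $g\in B_m(A)$, $f\oplus g\in B_{n+m}(A)$ applies $f$ to the first $n$ coordinates and $g$ to the last $m$; $\mathrm{id}_k$ is the identity of $A^k$. The extensions of $f\in B_\ell(A)$ on $A^n$, $n\ge\ell$, are the rewirings of $f\oplus \mathrm{id}_{n-\ell}$. For $P\subseteq B(A)$, $\lceil P\rceil\subseteq B(A)$ is the set of all gates obtained from $\mathrm{id}_1$ and the elements of $P$ by compositions of gates of equal arity and extensions. A set $C\subseteq B(A)$ with $C=\lceil C\rceil$ is called a revital. $A^*$ is the free monoid of words over $A$; $A^n$ is identified with the words of length $n$. The weight classes of $A^n$ under $\phi$ are the (non-empty) sets of words in $A^n$ having a common value under $\phi$. A gate $f\in B_n(A)$ is $\phi$-conservative if $\phi(f(x))=\phi(x)$ for all $x\in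 A^n$. $Cons^\phi(A)$ is the set of all $\phi$-conservative gates of all arities. The homomorphism $\phi$ is infinite-dimensional if for all $m\in\mathbb N$ there exists $n\in\mathbb N$ such that at least $m$ weight classes of $A^n$ under $\phi$ contain more than one word. -}

module Defs where

open import Algebra.Bundles using (CommutativeMonoid)
open import Data.Fin.Base using (Fin)
open import Data.Fin.Permutation as Perm using (Permutation′; _⟨$⟩ʳ_; _⟨$⟩ˡ_)
open import Data.List.Base using (List)
open import Data.List.Membership.Propositional using (_∈_)
open import Data.Nat.Base using (ℕ; suc; _+_; NonZero)
open import Data.Product.Base using (_×_; _,_; ∃; ∃-syntax; ∃₂; uncurry)
open import Data.Product.Function.NonDependent.Propositional using (_×-↔_)
open import Data.Vec.Base
  using (Vec; _++_; take; drop; lookup; tabulate; toList)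
open import Data.Vec.Properties
  using ( take++drop≡id; ++-injective
        ; lookup∘tabulate; tabulate∘lookup; tabulate-cong )
open import Function.Base using (_∘_)
open import Function.Bundles using (_↔_; mk↔ₛ′; module Inverse)
open import Function.Construct.Composition using (_↔-∘_)
open import Function.Construct.Identity using (↔-id)
open import Function.Construct.Symmetry using (↔-sym)
open import Function.Definitions using (Injective)
open import Level using (Level; _⊔_)
open import Relation.Binary.PropositionalEquality
  using (_≡_; _≢_; _≗_; refl; sym; trans; cong; cong₂)
open import Relation.Unary using (Pred; _≐_)

private
  variable
    a c p ℓ : Level

Sym : Set a → Set a
Sym X = X ↔ X

-- The instance makes ℓ + k positive whenever ℓ is.
+-nonZeroˡ : ∀ ℓ k → .{{NonZero ℓ}} → NonZero (ℓ + k)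
+-nonZeroˡ (suc _) _ = _

-- B(A): the arity is part of a gate and is positive.
record Gate (A : Set a) : Set a where
  constructor gate
  field
    {arity}         : ℕ
    .{{arity>0}}    : NonZero arity
    perm            : Sym (Vec A arity)

module _ {A : Set a} where

  -- (π α x)ᵢ = x at α⁻¹(i); _⟨$⟩ˡ_ is the action of the inverse of α.
  π : ∀ {n} → Permutation′ n → Sym (Vec A n)
  π α = mk↔ₛ′
    (λ x → tabulate (λ i → lookup x (α ⟨$⟩ˡ i)))
    (λ x → tabulate (λ i → lookup x (α ⟨$⟩ʳ i)))
    (λ x → trans
      (tabulate-cong (λ i → trans (lookup∘tabulate _ (α ⟨$⟩ˡ i))
                                  (cong (lookup x) (Perm.inverseʳ α))))
      (tabulate∘lookup x))
    (λ x → trans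
      (tabulate-cong (λ i → trans (lookup∘tabulate _ (α ⟨$⟩ʳ i))
                                  (cong (lookup x) (Perm.inverseˡ α))))
      (tabulate∘lookup x))

  rewire : ∀ {n} → Permutation′ n → Sym (Vec A n) → Sym (Vec A n)
  rewire α f = π α ↔-∘ (f ↔-∘ ↔-sym (π α))

  split : ∀ n m → Vec A (n + m) ↔ (Vec A n × Vec A m)
  split n m = mk↔ₛ′
    (λ z → take n z , drop n z)
    (uncurry _++_)
    (λ (x , y) → uncurry (cong₂ _,_)
      (++-injective (take n (x ++ y)) x (take++drop≡id n (x ++ y))))
    (take++drop≡id n)

  infixr 6 _⊕_

  _⊕_ : ∀ {n m} → Sym (Vec A n) → Sym (Vec A m) → Sym (Vec A (n + m))
  _⊕_ {n} {m} f g = ↔-sym (split n m) ↔-∘ ((f ×-↔ g) ↔-∘ split n m)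

  id⟨_⟩ : ∀ k → Sym (Vec A k)
  id⟨ k ⟩ = ↔-id (Vec A k)

  -- A gate is a map A ⁿ → A ⁿ, so only the pointwise behaviour of a
  -- bijection matters, not its proofs; in the absence of function
  -- extensionality, `resp` is what makes ⌈ P ⌉ a set of gates in this sense.
  data ⌈_⌉ (P : Pred (Gate A) p) : Pred (Gate A) (a ⊔ p) where
    id₁    : ⌈ P ⌉ (gate id⟨ 1 ⟩)
    gen    : ∀ {g} → P g → ⌈ P ⌉ g
    comp   : ∀ {n} .{{_ : NonZero n}} {f g : Sym (Vec A n)} →
             ⌈ P ⌉ (gate f) → ⌈ P ⌉ (gate g) → ⌈ P ⌉ (gate (f ↔-∘ g))
    extend : ∀ {ℓ} .{{_ : NonZero ℓ}} {f : Sym (Vec A ℓ)} →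
             ⌈ P ⌉ (gate f) → ∀ k (α : Permutation′ (ℓ + k)) →
             ⌈ P ⌉ (gate {{+-nonZeroˡ ℓ k}} (rewire α (f ⊕ id⟨ k ⟩)))
    resp   : ∀ {n} .{{_ : NonZero n}} {f g : Sym (Vec A n)} →
             Inverse.to f ≗ Inverse.to g → ⌈ P ⌉ (gate f) → ⌈ P ⌉ (gate g)

  -- Finite sets of gates are given by lists of their elements.
  FinitelyGenerated : Pred (Gate A) p → Set (a ⊔ p)
  FinitelyGenerated C = ∃[ gs ] ⌈ _∈ gs ⌉ ≐ C

MoreThanOne : {X : Set a} → Pred X p → Set (a ⊔ p)
MoreThanOne P = ∃₂ λ x y → x ≢ y × P x × P y

module _ {A : Set a} (M : CommutativeMonoid c ℓ)
         (φ : List A → CommutativeMonoid.Carrier M) where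

  open CommutativeMonoid M using (Carrier; _≈_)

  Cons : Pred (Gate A) (a ⊔ ℓ)
  Cons (gate f) = ∀ x → φ (toList (Inverse.to f x)) ≈ φ (toList x)

  WeightClass : ∀ n → Carrier → Pred (Vec A n) ℓ
  WeightClass n w x = φ (toList x) ≈ w

  -- Non-empty weight classes are distinct exactly when their values under φ
  -- are, so m distinct classes are given by m distinct values.
  InfiniteDimensional : Set (a ⊔ c ⊔ ℓ)
  InfiniteDimensional =
    ∀ m → ∃[ n ] ∃ λ (w : Fin m → Carrier) →
      Injective _≡_ _≈_ w × (∀ i → MoreThanOne (WeightClass n (w i)))

{-# OPTIONS --safe #-}
module Submission where

-- A conservative gate f on Aⁿ permutes every weight class, and the signs of
-- these permutations on m chosen classes form a vector in 𝔽₂ᵐ, which depends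
-- additively on f.  A generator on at most n wires can be extended to n wires
-- in many ways, but all of them are conjugate by weight-preserving
-- bijections, as M is commutative; hence it contributes a single vector.
-- So the gates on n wires generated by D gates realise at most 2 ^ D vectors,
-- whereas swapping two words in each of a chosen set of classes realises
-- every vector of 𝔽₂ᵐ, and m is arbitrary.
--
-- Signs are computed relative to a tournament in place of a linear order, and
-- each weight class has its own, in which the two words to be swapped are
-- adjacent.  Equality in M need not be decidable, but the conclusion is a
-- negation, so that finitely many instances of it may be assumed decided.

open import Defs
open import Algebra.Bundles using (CommutativeMonoid; CommutativeRing)
open import Algebra.Morphism.Structures using (IsMonoidHomomorphism)
import Algebra.Properties.CommutativeMonoid.Sum as CommutativeMonoidSum
import Algebra.Properties.Semiring.Sum as SemiringSum
open import Data.Bool.Base using (Bool; true; false; not; _∧_; _xor_; if_then_else_)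
open import Data.Bool.Properties
  using ( xor-∧-commutativeRing; xor-same; xor-comm; xor-identityʳ
        ; ∧-distribʳ-xor; ∧-zeroʳ; ∧-inverseʳ; not-¬ )
open import Data.Fin.Base using (Fin; zero; suc; toℕ; finToFun; funToFin)
open import Data.Fin.Permutation using (Permutation′; transpose; _⟨$⟩ʳ_)
open import Data.Fin.Properties
  using (_≟_; toℕ-injective; 2↔Bool; *↔×; finToFun-funToFin; sequence)
open import Data.List.Base as List using (List; ++-[]-rawMonoid)
open import Data.List.Membership.Propositional using (_∈_)
open import Data.List.Relation.Unary.Any using (index)
open import Data.List.Relation.Unary.Any.Properties using (lookup-index)
open import Data.Nat.Base using (ℕ; zero; suc; _+_; _∸_; _^_; _<ᵇ_; _≤_; NonZero)
open import Data.Nat.Properties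
  using ( _≤?_; m≤m+n; m+n∸m≡n; m+[n∸m]≡n; +-assoc; +-identityʳ; suc-injective )
open import Data.Product.Base using (_×_; _,_; ∃-syntax; proj₁; proj₂; Σ-syntax)
open import Data.Product.Function.NonDependent.Propositional using (_×-↔_)
open import Data.Vec.Base
  using (Vec; []; _∷_; _++_; take; drop; lookup; tabulate; toList)
open import Data.Vec.Properties using (toList-++; take++drop≡id; tabulate∘lookup)
open import Effect.Monad using (RawMonad)
open import Function.Base using (_∘_)
open import Function.Bundles using (_↔_; mk↔ₛ′; mk⇔; module Inverse)
open import Function.Construct.Composition using (_↔-∘_)
open import Function.Construct.Identity using (↔-id)
open import Function.Construct.Symmetry using (↔-sym)
open import Function.Definitions using (Injective)
open import Level using (Level; _⊔_)
open import Relation.Binary.Core using (Rel)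
open import Relation.Binary.Definitions using (Reflexive; Transitive)
open import Relation.Binary.PropositionalEquality
  using (_≡_; _≢_; _≗_; refl; sym; trans; cong; cong₂; subst; module ≡-Reasoning)
open import Relation.Nullary.Decidable
  using (Dec; yes; no; does; dec-true; dec-false; does-⇔; ¬¬-excluded-middle)
open import Relation.Nullary.Negation using (¬_; contradiction; ¬¬-Monad)
open import Relation.Unary using (_≐_)

open SemiringSum (CommutativeRing.semiring xor-∧-commutativeRing)
  using (sum; sum-syntax; sum-cong-≗; sum-replicate-zero; ∑-distrib-+; ∑-comm; ∑-permute)
open Inverse using (to; from; strictlyInverseˡ; strictlyInverseʳ)

private
  variable
    a c ℓ≈ : Level
    N : ℕ

-- Bijections, and sums over 𝔽₂ with `xor` as addition

to-injective : ∀ {b} {X : Set a} {Y : Set b} (e : X ↔ Y) → Injective _≡_ _≡_ (to e)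
to-injective e {x} {y} eq =
  trans (sym (strictlyInverseʳ e x)) (trans (cong (from e) eq) (strictlyInverseʳ e y))

xor≡false⇒≡ : ∀ {x y} → x xor y ≡ false → x ≡ y
xor≡false⇒≡ {false} {false} _ = refl
xor≡false⇒≡ {true}  {true}  _ = refl

sum-false : {h : Fin N → Bool} → (∀ p → h p ≡ false) → sum h ≡ false
sum-false {N} h≡0 = trans (sum-cong-≗ h≡0) (sum-replicate-zero N)

sum-single : {h : Fin N → Bool} (x : Fin N) → (∀ p → p ≢ x → h p ≡ false) → sum h ≡ h x
sum-single {suc N} {h} zero h≡0 =
  trans (cong (h zero xor_) (sum-false λ p → h≡0 (suc p) λ ())) (xor-identityʳ _)
sum-single {suc N} {h} (suc x) h≡0 =
  cong₂ _xor_ (h≡0 zero λ ())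
    (sum-single x λ p p≢x → h≡0 (suc p) λ { refl → p≢x refl })

-- The sign of a permutation, relative to a tournament

record IsTournament (t : Fin N → Fin N → Bool) : Set where
  field
    irrefl : ∀ p → t p p ≡ false
    total  : ∀ {p q} → p ≢ q → t q p ≡ not (t p q)

pullback : (Fin N → Fin N) → (Fin N → Fin N → Bool) → Fin N → Fin N → Bool
pullback f t p q = t (f p) (f q)

pullback-isTournament : ∀ {t} (f : Permutation′ N) →
  IsTournament t → IsTournament (pullback (f ⟨$⟩ʳ_) t)
pullback-isTournament f T = record
  { irrefl = λ p → irrefl _
  ; total  = λ p≢q → total (p≢q ∘ to-injective f)
  }
  where open IsTournament T

module _ {t : Fin N → Fin N → Bool} (T : IsTournament t) where
  open IsTournament T

  -- Over 𝔽₂ the terms at (p , q) and (q , p) cancel; the tournament selects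
  -- one pair from each such orbit.
  sum-symmetric : {h : Fin N → Fin N → Bool} →
    (∀ p q → h p q ≡ h q p) → (∀ p → h p p ≡ false) →
    (∑[ p < N ] ∑[ q < N ] h p q) ≡ false
  sum-symmetric {h} symm diag = begin
    (∑[ p < N ] ∑[ q < N ] h p q)
      ≡⟨ sum-cong-≗ (λ p → trans (sum-cong-≗ (halves p)) (∑-distrib-+ (upper p) (lower p))) ⟩
    (∑[ p < N ] ((∑[ q < N ] (t p q ∧ h p q)) xor (∑[ q < N ] (t q p ∧ h q p))))
      ≡⟨ ∑-distrib-+ (λ p → sum (upper p)) (λ p → sum (lower p)) ⟩
    (∑[ p < N ] ∑[ q < N ] (t p q ∧ h p q)) xor (∑[ p < N ] ∑[ q < N ] (t q p ∧ h q p))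
      ≡⟨ cong ((∑[ p < N ] ∑[ q < N ] (t p q ∧ h p q)) xor_) (∑-comm (λ p q → t q p ∧ h q p)) ⟩
    (∑[ p < N ] ∑[ q < N ] (t p q ∧ h p q)) xor (∑[ p < N ] ∑[ q < N ] (t p q ∧ h p q))
      ≡⟨ xor-same (∑[ p < N ] ∑[ q < N ] (t p q ∧ h p q)) ⟩
    false ∎
    where
    open ≡-Reasoning
    upper lower : Fin N → Fin N → Bool
    upper p q = t p q ∧ h p q
    lower p q = t q p ∧ h q p

    halves : ∀ p q → h p q ≡ (t p q ∧ h p q) xor (t q p ∧ h q p)
    halves p q with p ≟ q
    ... | yes refl = trans (diag p) (sym (xor-same (t p p ∧ h p p)))
    ... | no p≢q rewrite total p≢q | symm q p with t p q
    ...   | true  = sym (xor-identityʳ _)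
    ...   | false = refl

-- The number, modulo 2, of unordered pairs of elements of c on which two
-- tournaments disagree.
disagreement : (Fin N → Bool) → (t u : Fin N → Fin N → Bool) → Bool
disagreement {N} c t u = ∑[ p < N ] ∑[ q < N ] ((c p ∧ c q) ∧ (t p q ∧ not (u p q)))

disagreement-cong : ∀ (c : Fin N → Bool) {t t′ u u′} →
  (∀ p q → t p q ≡ t′ p q) → (∀ p q → u p q ≡ u′ p q) →
  disagreement c t u ≡ disagreement c t′ u′
disagreement-cong c t≡ u≡ = sum-cong-≗ λ p → sum-cong-≗ λ q →
  cong ((c p ∧ c q) ∧_) (cong₂ (λ x y → x ∧ not y) (t≡ p q) (u≡ p q))

disagreement-pullback : ∀ (c : Fin N → Bool) t u (g : Permutation′ N) →
  (∀ p → c (g ⟨$⟩ʳ p) ≡ c p) →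
  disagreement c (pullback (g ⟨$⟩ʳ_) t) (pullback (g ⟨$⟩ʳ_) u) ≡ disagreement c t u
disagreement-pullback {N} c t u g cg≡c = sym (begin
  disagreement c t u
    ≡⟨ ∑-permute (λ p → ∑[ q < N ] term p q) g ⟩
  (∑[ p < N ] ∑[ q < N ] term (g ⟨$⟩ʳ p) q)
    ≡⟨ sum-cong-≗ (λ p → ∑-permute (term (g ⟨$⟩ʳ p)) g) ⟩
  (∑[ p < N ] ∑[ q < N ] term (g ⟨$⟩ʳ p) (g ⟨$⟩ʳ q))
    ≡⟨ sum-cong-≗ (λ p → sum-cong-≗ λ q → cong (_∧ _) (cong₂ _∧_ (cg≡c p) (cg≡c q))) ⟩
  disagreement c (pullback (g ⟨$⟩ʳ_) t) (pullback (g ⟨$⟩ʳ_) u) ∎)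
  where
  open ≡-Reasoning
  term : Fin N → Fin N → Bool
  term p q = (c p ∧ c q) ∧ (t p q ∧ not (u p q))

-- The two orders of a pair of distinct elements of `c` together contribute `t p q xor u p q`, and
-- such differences telescope. Formally, the sum of all three disagreements has a summand that is
-- symmetric in `p` and `q` and vanishes on the diagonal.
disagreement-cocycle : ∀ (c : Fin N → Bool) {t u v} →
  IsTournament t → IsTournament u → IsTournament v →
  disagreement c t u xor disagreement c u v ≡ disagreement c t v
disagreement-cocycle {N} c {t} {u} {v} T U V = xor≡false⇒≡ (begin
  (disagreement c t u xor disagreement c u v) xor disagreement c t v
    ≡⟨ cong (_xor disagreement c t v) (merge (term t u) (term u v)) ⟩
  (∑[ p < N ] ∑[ q < N ] (term t u p q xor term u v p q)) xor disagreement c t v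
    ≡⟨ merge (λ p q → term t u p q xor term u v p q) (term t v) ⟩
  (∑[ p < N ] ∑[ q < N ] ((term t u p q xor term u v p q) xor term t v p q))
    ≡⟨ sum-symmetric T symm diag ⟩
  false ∎)
  where
  open ≡-Reasoning
  open IsTournament

  term : (t u : Fin N → Fin N → Bool) → Fin N → Fin N → Bool
  term t u p q = (c p ∧ c q) ∧ (t p q ∧ not (u p q))

  merge : (h k : Fin N → Fin N → Bool) →
    (∑[ p < N ] ∑[ q < N ] h p q) xor (∑[ p < N ] ∑[ q < N ] k p q) ≡
    (∑[ p < N ] ∑[ q < N ] (h p q xor k p q))
  merge h k = sym (trans (sum-cong-≗ λ p → ∑-distrib-+ (h p) (k p)) (∑-distrib-+ (λ p → sum (h p)) (λ p → sum (k p))))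

  -- The combined summand at `(p , q)` as a Boolean function of the two memberships in `c` and the
  -- three orientations. For `p ≢ q`, exchanging `p` and `q` negates all three orientations, so
  -- symmetry becomes a finite check.
  poly : (b b′ x y z : Bool) → Bool
  poly b b′ x y z =
    (((b ∧ b′) ∧ (x ∧ not y)) xor ((b ∧ b′) ∧ (y ∧ not z))) xor ((b ∧ b′) ∧ (x ∧ not z))

  poly-symm : ∀ b b′ x y z → poly b b′ x y z ≡ poly b′ b (not x) (not y) (not z)
  poly-symm false false x     y     z     = refl
  poly-symm false true  x     y     z     = refl
  poly-symm true  false x     y     z     = refl
  poly-symm true  true  false false false = refl
  poly-symm true  true  false false true  = refl
  poly-symm true  true  false true  false = refl
  poly-symm true  true  false true  true  = refl
  poly-symm true  true  true  false false = refl
  poly-symm true  true  true  false true  = refl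
  poly-symm true  true  true  true  false = refl
  poly-symm true  true  true  true  true  = refl

  symm : ∀ p q → poly (c p) (c q) (t p q) (u p q) (v p q) ≡
                 poly (c q) (c p) (t q p) (u q p) (v q p)
  symm p q with p ≟ q
  ... | yes refl = refl
  ... | no p≢q rewrite total T p≢q | total U p≢q | total V p≢q =
    poly-symm (c p) (c q) (t p q) (u p q) (v p q)

  diag : ∀ p → poly (c p) (c p) (t p p) (u p p) (v p p) ≡ false
  diag p rewrite irrefl T p | irrefl U p with c p
  ... | true  = refl
  ... | false = refl

-- The sign of f on the set c, which f is meant to preserve.
parity : (Fin N → Bool) → (Fin N → Fin N → Bool) → (Fin N → Fin N) → Bool
parity c t f = disagreement c t (pullback f t)

parity-cong : ∀ (c : Fin N → Bool) t {f g} → f ≗ g → parity c t f ≡ parity c t g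
parity-cong c t f≗g =
  disagreement-cong c (λ _ _ → refl) (λ p q → cong₂ t (f≗g p) (f≗g q))

-- No pair inside `c` changes its orientation. Outside `c` the map is arbitrary, so this also covers
-- exchanges that take place in a different weight class.
parity-fixed : ∀ (c : Fin N → Bool) t {f} →
  (∀ p → c p ≡ true → f p ≡ p) → parity c t f ≡ false
parity-fixed c t {f} fix = sum-false λ p → sum-false λ q → go p q
  where
  go : ∀ p q → (c p ∧ c q) ∧ (t p q ∧ not (t (f p) (f q))) ≡ false
  go p q with c p in cp | c q in cq
  ... | false | _     = refl
  ... | true  | false = refl
  ... | true  | true  rewrite fix p cp | fix q cq = ∧-inverseʳ (t p q)

-- The cocycle identity, with `t` pulled back along `g` as the middle tournament. The second
-- disagreement is that of `t` with its pullback along `f`, relabelled by `g`, which preserves `c`.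
parity-∘ : ∀ (c : Fin N → Bool) {t} → IsTournament t → (f g : Permutation′ N) →
  (∀ p → c (g ⟨$⟩ʳ p) ≡ c p) →
  parity c t (to (f ↔-∘ g)) ≡ parity c t (to f) xor parity c t (to g)
parity-∘ c {t} T f g cg≡c = begin
  parity c t (to (f ↔-∘ g))
    ≡⟨ disagreement-cocycle c T (pullback-isTournament g T)
         (pullback-isTournament (f ↔-∘ g) T) ⟨
  parity c t (to g) xor disagreement c (pullback (to g) t) (pullback (to g) (pullback (to f) t))
    ≡⟨ cong (parity c t (to g) xor_) (disagreement-pullback c t (pullback (to f) t) g cg≡c) ⟩
  parity c t (to g) xor parity c t (to f)
    ≡⟨ xor-comm (parity c t (to g)) _ ⟩
  parity c t (to f) xor parity c t (to g) ∎
  where open ≡-Reasoning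

-- The sign takes values in an abelian group, so the contribution of `h` cancels: conjugate
-- permutations have equal signs.
parity-intertwined : ∀ (c : Fin N → Bool) {t} → IsTournament t → (f g h : Permutation′ N) →
  (∀ p → c (f ⟨$⟩ʳ p) ≡ c p) → (∀ p → c (h ⟨$⟩ʳ p) ≡ c p) →
  to (h ↔-∘ f) ≗ to (g ↔-∘ h) → parity c t (to f) ≡ parity c t (to g)
parity-intertwined c {t} T f g h cf≡c ch≡c hf≗gh =
  cancel (parity c t (to h)) (begin
    parity c t (to h) xor parity c t (to f)  ≡⟨ parity-∘ c T h f cf≡c ⟨
    parity c t (to (h ↔-∘ f))                ≡⟨ parity-cong c t hf≗gh ⟩
    parity c t (to (g ↔-∘ h))                ≡⟨ parity-∘ c T g h ch≡c ⟩
    parity c t (to g) xor parity c t (to h)  ≡⟨ xor-comm (parity c t (to g)) _ ⟩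
    parity c t (to h) xor parity c t (to g)  ∎)
  where
  open ≡-Reasoning
  cancel : ∀ b {x y} → b xor x ≡ b xor y → x ≡ y
  cancel false eq = eq
  cancel true {false} {false} _ = refl
  cancel true {true}  {true}  _ = refl

-- The sign of a transposition

module _ (x y : Fin N) where

  transpose-fst : transpose x y ⟨$⟩ʳ x ≡ y
  transpose-fst rewrite dec-true (x ≟ x) refl = refl

  transpose-snd : transpose x y ⟨$⟩ʳ y ≡ x
  transpose-snd with y ≟ x
  ... | yes y≡x = y≡x
  ... | no _ rewrite dec-true (y ≟ y) refl = refl

  transpose-fixed : ∀ {p} → p ≢ x → p ≢ y → transpose x y ⟨$⟩ʳ p ≡ p
  transpose-fixed {p} p≢x p≢y
    rewrite dec-false (p ≟ x) p≢x | dec-false (p ≟ y) p≢y = refl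

-- With x and y adjacent in the tournament, {x , y} is the only pair whose
-- orientation their exchange changes.
parity-exchange : ∀ (c : Fin N → Bool) {t} → IsTournament t → ∀ {x y} → x ≢ y →
  t x y ≡ true → (∀ {p} → p ≢ x → p ≢ y → t x p ≡ t y p) →
  c x ≡ true → c y ≡ true →
  (τ : Fin N → Fin N) → τ x ≡ y → τ y ≡ x → (∀ {p} → p ≢ x → p ≢ y → τ p ≡ p) →
  parity c t τ ≡ true
parity-exchange {N} c {t} T {x} {y} x≢y xy adj cx cy τ τx τy τp = begin
  (∑[ p < N ] ∑[ q < N ] ((c p ∧ c q) ∧ (t p q ∧ not (t (τ p) (τ q)))))
    ≡⟨ sum-single x (λ p p≢x → sum-false λ q →
         trans (cong ((c p ∧ c q) ∧_) (rows p q p≢x)) (∧-zeroʳ (c p ∧ c q))) ⟩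
  (∑[ q < N ] ((c x ∧ c q) ∧ (t x q ∧ not (t (τ x) (τ q)))))
    ≡⟨ sum-single y (λ q q≢y →
         trans (cong ((c x ∧ c q) ∧_) (row q q≢y)) (∧-zeroʳ (c x ∧ c q))) ⟩
  (c x ∧ c y) ∧ (t x y ∧ not (t (τ x) (τ y)))
    ≡⟨ value ⟩
  true ∎
  where
  open ≡-Reasoning
  open IsTournament T

  adj′ : ∀ {p} → p ≢ x → p ≢ y → t p x ≡ t p y
  adj′ p≢x p≢y =
    trans (total (p≢x ∘ sym)) (trans (cong not (adj p≢x p≢y)) (sym (total (p≢y ∘ sym))))

  row : ∀ q → q ≢ y → t x q ∧ not (t (τ x) (τ q)) ≡ false
  row q q≢y with q ≟ x
  ... | yes refl rewrite irrefl x = refl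
  ... | no q≢x rewrite τx | τp q≢x q≢y | adj q≢x q≢y = ∧-inverseʳ (t y q)

  rows : ∀ p q → p ≢ x → t p q ∧ not (t (τ p) (τ q)) ≡ false
  rows p q p≢x with p ≟ y
  rows p q p≢x | yes refl with q ≟ x | q ≟ y
  -- Of the two orders of the exchanged pair, `(y , x)` contributes nothing because `t y x` is
  -- false; hence the total is odd.
  ... | yes refl | _        rewrite total x≢y | xy = refl
  ... | no _     | yes refl rewrite irrefl y = refl
  ... | no q≢x   | no q≢y   rewrite τy | τp q≢x q≢y | adj q≢x q≢y = ∧-inverseʳ (t y q)
  rows p q p≢x | no p≢y rewrite τp p≢x p≢y with q ≟ x | q ≟ y
  ... | yes refl | _        rewrite τx | adj′ p≢x p≢y = ∧-inverseʳ (t p y)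
  ... | no _     | yes refl rewrite τy | adj′ p≢x p≢y = ∧-inverseʳ (t p y)
  ... | no q≢x   | no q≢y   rewrite τp q≢x q≢y = ∧-inverseʳ (t p q)

  value : (c x ∧ c y) ∧ (t x y ∧ not (t (τ x) (τ y))) ≡ true
  value rewrite cx | cy | τx | τy | total x≢y | xy = refl

module _ (x y : Fin N) where

  -- Ranking `x` and `y` lowest makes them adjacent: all other elements compare in the same way with
  -- both, as `parity-exchange` demands. The remaining ranks are shifted by two to make room.
  rank : Fin N → ℕ
  rank p = if does (p ≟ x) then 0 else if does (p ≟ y) then 1 else suc (suc (toℕ p))

  rank-injective : Injective _≡_ _≡_ rank
  rank-injective {p} {q} eq with p ≟ x | q ≟ x | p ≟ y | q ≟ y
  ... | yes p≡x | yes q≡x | _       | _       = trans p≡x (sym q≡x)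
  ... | no _    | no _    | yes p≡y | yes q≡y = trans p≡y (sym q≡y)
  ... | no _    | no _    | no _    | no _    = toℕ-injective (suc-injective (suc-injective eq))
  rank-injective () | yes _ | no _  | _     | yes _
  rank-injective () | yes _ | no _  | _     | no _
  rank-injective () | no _  | yes _ | yes _ | _
  rank-injective () | no _  | yes _ | no _  | _
  rank-injective () | no _  | no _  | yes _ | no _
  rank-injective () | no _  | no _  | no _  | yes _

  startingWith : Fin N → Fin N → Bool
  startingWith p q = rank p <ᵇ rank q

  startingWith-isTournament : IsTournament startingWith
  startingWith-isTournament = record
    { irrefl = λ p → <ᵇ-irrefl (rank p)
    ; total  = λ p≢q → <ᵇ-total _ _ (p≢q ∘ rank-injective)
    }
    where
    <ᵇ-irrefl : ∀ m → (m <ᵇ m) ≡ false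
    <ᵇ-irrefl zero    = refl
    <ᵇ-irrefl (suc m) = <ᵇ-irrefl m

    <ᵇ-total : ∀ m n → m ≢ n → (n <ᵇ m) ≡ not (m <ᵇ n)
    <ᵇ-total zero    zero    m≢n = contradiction refl m≢n
    <ᵇ-total zero    (suc n) _   = refl
    <ᵇ-total (suc m) zero    _   = refl
    <ᵇ-total (suc m) (suc n) m≢n = <ᵇ-total m n (m≢n ∘ cong suc)

  parity-transpose : ∀ (c : Fin N → Bool) → x ≢ y → c x ≡ true → c y ≡ true →
    parity c startingWith (transpose x y ⟨$⟩ʳ_) ≡ true
  parity-transpose c x≢y cx cy =
    parity-exchange c startingWith-isTournament x≢y x<y adjacent cx cy
      (transpose x y ⟨$⟩ʳ_) (transpose-fst x y) (transpose-snd x y) (transpose-fixed x y)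
    where
    x<y : startingWith x y ≡ true
    x<y rewrite dec-true (x ≟ x) refl | dec-false (y ≟ x) (x≢y ∘ sym)
              | dec-true (y ≟ y) refl = refl

    adjacent : ∀ {p} → p ≢ x → p ≢ y → startingWith x p ≡ startingWith y p
    adjacent {p} p≢x p≢y
      rewrite dec-true (x ≟ x) refl | dec-false (y ≟ x) (x≢y ∘ sym)
            | dec-true (y ≟ y) refl | dec-false (p ≟ x) p≢x | dec-false (p ≟ y) p≢y = refl

-- Spans over 𝔽₂

module _ {D m : ℕ} (V : Fin D → Fin m → Bool) where

  combination : (Fin D → Bool) → Fin m → Bool
  combination s i = ∑[ j < D ] (s j ∧ V j i)

  InSpan : (Fin m → Bool) → Set
  InSpan u = ∃[ s ] ∀ i → u i ≡ combination s i

  InSpan-resp : ∀ {u v} → (∀ i → u i ≡ v i) → InSpan u → InSpan v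
  InSpan-resp u≡v (s , eq) = s , λ i → trans (sym (u≡v i)) (eq i)

  InSpan-zero : InSpan (λ _ → false)
  InSpan-zero = (λ _ → false) , λ i → sym (sum-false {D} λ j → refl)

  InSpan-xor : ∀ {u v} → InSpan u → InSpan v → InSpan (λ i → u i xor v i)
  InSpan-xor (s , u≡) (s′ , v≡) = (λ j → s j xor s′ j) , λ i → trans
    (cong₂ _xor_ (u≡ i) (v≡ i))
    (trans (sym (∑-distrib-+ (λ j → s j ∧ V j i) (λ j → s′ j ∧ V j i)))
           (sum-cong-≗ λ j → sym (∧-distribʳ-xor (V j i) (s j) (s′ j))))

  InSpan-generator : ∀ j → InSpan (V j)
  InSpan-generator j = (λ j′ → does (j′ ≟ j)) , λ i → sym (trans
    (sum-single j λ j′ j′≢j → cong (_∧ V j′ i) (dec-false (j′ ≟ j) j′≢j))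
    (cong (_∧ V j i) (dec-true (j ≟ j) refl)))

-- Cantor's diagonal: the combinations of D vectors are indexed by Fin (2 ^ D).
∃-outside-span : ∀ {D} (V : Fin D → Fin (2 ^ D) → Bool) → ∃[ u ] ¬ InSpan V u
∃-outside-span {D} V = u , λ (s , u≡) → not-¬ refl
  (trans (sym (u≡ (code s)))
    (cong not (sum-cong-≗ λ j → cong (_∧ V j (code s)) (decode-code s j))))
  where
  decode : Fin (2 ^ D) → Fin D → Bool
  decode i j = to 2↔Bool (finToFun i j)

  code : (Fin D → Bool) → Fin (2 ^ D)
  code s = funToFin (from 2↔Bool ∘ s)

  decode-code : ∀ s j → decode (code s) j ≡ s j
  decode-code s j = trans (cong (to 2↔Bool) (finToFun-funToFin (from 2↔Bool ∘ s) j))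
                          (strictlyInverseˡ 2↔Bool (s j))

  u : Fin (2 ^ D) → Bool
  u i = not (combination V (decode i) i)

-- Enumerating and cutting words; products of permutations

Fin↔Vec : ∀ {A : Set a} {k} → A ↔ Fin k → ∀ n → Fin (k ^ n) ↔ Vec A n
Fin↔Vec A↔Fin zero    = mk↔ₛ′ (λ _ → []) (λ _ → zero) (λ { [] → refl }) (λ { zero → refl })
Fin↔Vec A↔Fin (suc n) =
  mk↔ₛ′ (λ (x , xs) → x ∷ xs) (λ { (x ∷ xs) → x , xs })
    (λ { (x ∷ xs) → refl }) (λ { (x , xs) → refl })
  ↔-∘ ((↔-sym A↔Fin ×-↔ Fin↔Vec A↔Fin n) ↔-∘ *↔×)

-- The equation is an argument so that `n` can stay fixed while `ℓ` and `k` vary: all cuts then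
-- start from the same set of words.
splitAlong : ∀ {A : Set a} {n ℓ k} → ℓ + k ≡ n → Vec A n ↔ (Vec A ℓ × Vec A k)
splitAlong {ℓ = ℓ} {k} refl = split ℓ k

×-split : ∀ {b} {A : Set a} {Y : Set b} ℓ k →
  (Vec A (ℓ + k) × Y) ↔ (Vec A ℓ × (Vec A k × Y))
×-split ℓ k =
  mk↔ₛ′ (λ ((x , y) , z) → x , (y , z)) (λ (x , (y , z)) → (x , y) , z)
    (λ _ → refl) (λ _ → refl)
  ↔-∘ (split ℓ k ×-↔ ↔-id _)

compose : ∀ {r} → (Fin r → Permutation′ N) → Permutation′ N
compose {r = zero}  τ = ↔-id _
compose {r = suc r} τ = τ zero ↔-∘ compose (τ ∘ suc)

-- The relation is left general because two instances occur: equal membership in a class, and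
-- equality of weights in `M`.
compose-respects : ∀ {r e} {_∼_ : Rel (Fin N) e} → Reflexive _∼_ → Transitive _∼_ →
  (τ : Fin r → Permutation′ N) → (∀ j p → (τ j ⟨$⟩ʳ p) ∼ p) → ∀ p → (compose τ ⟨$⟩ʳ p) ∼ p
compose-respects {r = zero}  ∼-refl ∼-trans τ τ∼ p = ∼-refl
compose-respects {r = suc r} ∼-refl ∼-trans τ τ∼ p =
  ∼-trans (τ∼ zero _) (compose-respects ∼-refl ∼-trans (τ ∘ suc) (τ∼ ∘ suc) p)

parity-compose : ∀ {r} (c : Fin N → Bool) {t} → IsTournament t → (τ : Fin r → Permutation′ N) →
  (∀ j p → c (τ j ⟨$⟩ʳ p) ≡ c p) →
  parity c t (compose τ ⟨$⟩ʳ_) ≡ ∑[ j < r ] parity c t (τ j ⟨$⟩ʳ_)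
parity-compose {r = zero}  c {t} T τ cτ≡c = parity-fixed c t λ _ _ → refl
parity-compose {r = suc r} c {t} T τ cτ≡c = trans
  (parity-∘ c T (τ zero) (compose (τ ∘ suc))
    (compose-respects {_∼_ = λ p q → c p ≡ c q} refl trans (τ ∘ suc) (cτ≡c ∘ suc)))
  (cong (parity c t (τ zero ⟨$⟩ʳ_) xor_) (parity-compose c T (τ ∘ suc) (cτ≡c ∘ suc)))

does⁻¹ : ∀ {p} {P : Set p} (P? : Dec P) → does P? ≡ true → P
does⁻¹ (yes p) _ = p

-- Weights of words

module _ {A : Set a} (M : CommutativeMonoid c ℓ≈) (φ : List A → CommutativeMonoid.Carrier M)
  (φ-hom : IsMonoidHomomorphism (++-[]-rawMonoid A) (CommutativeMonoid.rawMonoid M) φ) where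

  open CommutativeMonoid M
    using (Carrier; _≈_; _∙_; setoid; ∙-congˡ; ∙-congʳ)
    renaming ( refl to ≈-refl; sym to ≈-sym; trans to ≈-trans; reflexive to ≈-reflexive
             ; assoc to ∙-assoc; identityʳ to ∙-identityʳ )
  open IsMonoidHomomorphism φ-hom using (homo; ε-homo)
  module ∑M = CommutativeMonoidSum M

  weight : ∀ {n} → Vec A n → Carrier
  weight x = φ (toList x)

  weight-++ : ∀ {m n} (x : Vec A m) (y : Vec A n) → weight (x ++ y) ≈ weight x ∙ weight y
  weight-++ x y = ≈-trans (≈-reflexive (cong φ (toList-++ x y))) (homo (toList x) (toList y))

  weight₂ : ∀ {m n} → Vec A m × Vec A n → Carrier
  weight₂ (x , y) = weight x ∙ weight y

  weight-splitAlong : ∀ {n ℓ k} (eq : ℓ + k ≡ n) (x : Vec A n) →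
    weight₂ (to (splitAlong {ℓ = ℓ} {k} eq) x) ≈ weight x
  weight-splitAlong {ℓ = ℓ} refl x = ≈-trans
    (≈-sym (weight-++ (take ℓ x) (drop ℓ x)))
    (≈-reflexive (cong weight (take++drop≡id ℓ x)))

  weight-tabulate : ∀ {n} (x : Fin n → A) →
    weight (tabulate x) ≈ ∑M.sum (λ i → φ (x i List.∷ List.[]))
  weight-tabulate {zero}  x = ε-homo
  weight-tabulate {suc n} x =
    ≈-trans (homo (x zero List.∷ List.[]) _) (∙-congˡ (weight-tabulate (x ∘ suc)))

  -- Commutativity of `M` enters here: the weight of a word is the sum of the weights of its
  -- letters, and a sum may be permuted.
  weight-π : ∀ {n} (α : Permutation′ n) (x : Vec A n) → weight (from (π α) x) ≈ weight x
  weight-π α x = begin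
    weight (tabulate (λ i → lookup x (α ⟨$⟩ʳ i)))
      ≈⟨ weight-tabulate (λ i → lookup x (α ⟨$⟩ʳ i)) ⟩
    ∑M.sum (λ i → φ (lookup x (α ⟨$⟩ʳ i) List.∷ List.[]))
      ≈⟨ ∑M.sum-permute (λ i → φ (lookup x i List.∷ List.[])) α ⟨
    ∑M.sum (λ i → φ (lookup x i List.∷ List.[]))
      ≈⟨ weight-tabulate (lookup x) ⟨
    weight (tabulate (lookup x))
      ≡⟨ cong weight (tabulate∘lookup x) ⟩
    weight x ∎
    where open import Relation.Binary.Reasoning.Setoid setoid

  -- Parity vectors of the gates on `n` wires

  module _ {k} (A↔Fin : A ↔ Fin k) {gs : List (Gate A)}
    (gs≐Cons : ⌈ _∈ gs ⌉ ≐ Cons M φ)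
    {n : ℕ} .{{_ : NonZero n}} {m : ℕ}
    (w : Fin m → Carrier) (w-injective : Injective _≡_ _≈_ w)
    (more : ∀ i → MoreThanOne (WeightClass M φ n (w i)))
    where

    private
      #Aⁿ : ℕ
      #Aⁿ = k ^ n

      word : Fin #Aⁿ ↔ Vec A n
      word = Fin↔Vec A↔Fin n

      ∣_∣ : Fin #Aⁿ → Carrier
      ∣ p ∣ = weight (to word p)

      x₁ x₂ : Fin m → Fin #Aⁿ
      x₁ i = from word (proj₁ (more i))
      x₂ i = from word (proj₁ (proj₂ (more i)))

      x₁≢x₂ : ∀ i → x₁ i ≢ x₂ i
      x₁≢x₂ i eq = proj₁ (proj₂ (proj₂ (more i))) (to-injective (↔-sym word) eq)

      ∣x₁∣ : ∀ i → ∣ x₁ i ∣ ≈ w i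
      ∣x₁∣ i = ≈-trans (≈-reflexive (cong weight (strictlyInverseˡ word _)))
                       (proj₁ (proj₂ (proj₂ (proj₂ (more i)))))

      ∣x₂∣ : ∀ i → ∣ x₂ i ∣ ≈ w i
      ∣x₂∣ i = ≈-trans (≈-reflexive (cong weight (strictlyInverseˡ word _)))
                       (proj₂ (proj₂ (proj₂ (proj₂ (more i)))))

    module _ (∣_∣≈?_ : ∀ p i → Dec (∣ p ∣ ≈ w i)) where

      private
        class : Fin m → Fin #Aⁿ → Bool
        class i p = does (∣ p ∣≈? i)

        class-cong : ∀ i {p q} → ∣ p ∣ ≈ ∣ q ∣ → class i p ≡ class i q
        class-cong i {p} {q} p≈q =
          does-⇔ (mk⇔ (≈-trans (≈-sym p≈q)) (≈-trans p≈q)) (∣ p ∣≈? i) (∣ q ∣≈? i)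

        tournament : Fin m → Fin #Aⁿ → Fin #Aⁿ → Bool
        tournament i = startingWith (x₁ i) (x₂ i)

        isTournament : ∀ i → IsTournament (tournament i)
        isTournament i = startingWith-isTournament (x₁ i) (x₂ i)

        parities : (Fin #Aⁿ → Fin #Aⁿ) → Fin m → Bool
        parities f i = parity (class i) (tournament i) f

        Cut : ℕ → ℕ → Set (a ⊔ ℓ≈)
        Cut ℓ k = Σ[ e ∈ (Fin #Aⁿ ↔ (Vec A ℓ × Vec A k)) ]
          ∀ p → weight₂ (to e p) ≈ ∣ p ∣

        cut : ∀ {ℓ k} → ℓ + k ≡ n → Cut ℓ k
        cut eq = splitAlong eq ↔-∘ word , λ p → weight-splitAlong eq (to word p)

        act : ∀ {ℓ k} → Cut ℓ k → Sym (Vec A ℓ) → Permutation′ #Aⁿ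
        act (e , _) f = ↔-sym e ↔-∘ ((f ×-↔ ↔-id _) ↔-∘ e)

        Conserves : ∀ {ℓ} → Sym (Vec A ℓ) → Set (a ⊔ ℓ≈)
        Conserves f = ∀ x → weight (to f x) ≈ weight x

        Cut-intertwines : ∀ {ℓ k} (C C′ : Cut ℓ k) p → ∣ from (proj₁ C′) (to (proj₁ C) p) ∣ ≈ ∣ p ∣
        Cut-intertwines (e , e≈) (e′ , e′≈) p = ≈-trans (≈-sym (e′≈ _)) (≈-trans
          (≈-reflexive (cong weight₂ (strictlyInverseˡ e′ (to e p))))
          (e≈ p))

        act-conserves : ∀ {ℓ k} (C : Cut ℓ k) (f : Sym (Vec A ℓ)) → Conserves f →
          ∀ p → ∣ act C f ⟨$⟩ʳ p ∣ ≈ ∣ p ∣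
        act-conserves (e , e≈) f f-cons p = ≈-trans (≈-sym (e≈ _)) (≈-trans
          (≈-reflexive (cong weight₂ (strictlyInverseˡ e _)))
          (≈-trans (∙-congʳ (f-cons _)) (e≈ p)))

        -- Passing from one cut to the other is a weight-preserving bijection that conjugates the
        -- first action into the second. Hence a gate has one parity vector, wherever it is applied.
        parities-act : ∀ {ℓ k} (C C′ : Cut ℓ k) (f : Sym (Vec A ℓ)) → Conserves f →
          ∀ i → parities (to (act C f)) i ≡ parities (to (act C′ f)) i
        parities-act C@(e , _) C′@(e′ , _) f f-cons i =
          parity-intertwined (class i) (isTournament i) (act C f) (act C′ f) (↔-sym e′ ↔-∘ e)
            (class-cong i ∘ act-conserves C f f-cons)
            (class-cong i ∘ Cut-intertwines C C′)
            λ p → cong (from e′) (trans (strictlyInverseˡ e _)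
              (cong (λ (x , y) → to f x , y) (sym (strictlyInverseˡ e′ (to e p)))))

        -- The value in the second case, which never occurs below, is arbitrary.
        gateParities : Gate A → Fin m → Bool
        gateParities (gate {ℓ} f) with ℓ ≤? n
        ... | yes ℓ≤n = parities (to (act (cut (m+[n∸m]≡n ℓ≤n)) f))
        ... | no  _   = λ _ → false

        gateParities-act : ∀ {ℓ k} .{{_ : NonZero ℓ}} → ℓ + k ≡ n → (C : Cut ℓ k)
          (f : Sym (Vec A ℓ)) → Conserves f →
          ∀ i → gateParities (gate f) i ≡ parities (to (act C f)) i
        gateParities-act {ℓ} {k} ℓ+k≡n C f f-cons i with ℓ ≤? n
        ... | no ℓ≰n  = contradiction (subst (ℓ ≤_) ℓ+k≡n (m≤m+n ℓ k)) ℓ≰n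
        -- `gateParities` sets `n ∸ ℓ` wires aside; identifying this number with `k` gives both cuts
        -- the same type.
        ... | yes ℓ≤n with refl ← trans (sym (m+n∸m≡n ℓ k)) (cong (_∸ ℓ) ℓ+k≡n) =
          parities-act (cut (m+[n∸m]≡n ℓ≤n)) C f f-cons i

        generatorParities : Fin (List.length gs) → Fin m → Bool
        generatorParities j = gateParities (List.lookup gs j)

        conserves : ∀ {ℓ} .{{_ : NonZero ℓ}} {f : Sym (Vec A ℓ)} → ⌈ _∈ gs ⌉ (gate f) → Conserves f
        conserves = proj₁ gs≐Cons

        -- Cutting ℓ + k wires, undoing α on them, then setting k of them aside.
        refine : ∀ {ℓ k k′} → Permutation′ (ℓ + k) → Cut (ℓ + k) k′ → Cut ℓ (k + k′)
        refine {ℓ} {k} {k′} α (e , e≈) =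
          (↔-id _ ×-↔ ↔-sym (split k k′)) ↔-∘ (×-split ℓ k ↔-∘ ((↔-sym (π α) ×-↔ ↔-id _) ↔-∘ e)) ,
          λ p → let (x , y) = to e p ; z = from (π α) x in begin
            weight (take ℓ z) ∙ weight (drop ℓ z ++ y)             ≈⟨ ∙-congˡ (weight-++ (drop ℓ z) y) ⟩
            weight (take ℓ z) ∙ (weight (drop ℓ z) ∙ weight y)     ≈⟨ ∙-assoc _ _ _ ⟨
            (weight (take ℓ z) ∙ weight (drop ℓ z)) ∙ weight y     ≈⟨ ∙-congʳ (weight-splitAlong {ℓ = ℓ} {k} refl z) ⟩
            weight z ∙ weight y                                    ≈⟨ ∙-congʳ (weight-π α x) ⟩
            weight x ∙ weight y                                    ≈⟨ e≈ p ⟩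
            ∣ p ∣ ∎
          where open import Relation.Binary.Reasoning.Setoid setoid

        -- The inverse of the refined cut restores the rewiring that the cut undid. An extension of
        -- `f` is thus `f` itself acting along another cut.
        act-refine : ∀ {ℓ k k′} (α : Permutation′ (ℓ + k)) (C : Cut (ℓ + k) k′) (f : Sym (Vec A ℓ)) →
          to (act (refine α C) f) ≗ to (act C (rewire α (f ⊕ id⟨ k ⟩)))
        act-refine {ℓ} {k} {k′} α (e , _) f p =
          cong (λ (v , y) → from e (to (π α) (to f (take ℓ z) ++ v) , y))
            (strictlyInverseˡ (split k k′) (drop ℓ z , proj₂ (to e p)))
          where z = from (π α) (proj₁ (to e p))

        -- Induction on the derivation, for all arities up to `n` and all cuts at once, because the
        -- premise of `extend` has arity `ℓ` instead of `ℓ + k` and acts along a refined cut. The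
        -- identity gives zero, a generator its own vector, and a composition the sum; extensions
        -- and pointwise equality change nothing.
        parities∈span : ∀ {ℓ} .{{_ : NonZero ℓ}} {f : Sym (Vec A ℓ)} → ⌈ _∈ gs ⌉ (gate f) →
          ∀ {k} → ℓ + k ≡ n → (C : Cut ℓ k) → InSpan generatorParities (parities (to (act C f)))
        parities∈span id₁ _ C@(e , _) =
          InSpan-resp generatorParities
            (λ i → sym (parity-fixed (class i) (tournament i) λ p _ → strictlyInverseʳ e p))
            (InSpan-zero generatorParities)
        parities∈span {f = f} (gen f∈gs) ℓ+k≡n C =
          InSpan-resp generatorParities
            (λ i → trans (cong (λ g → gateParities g i) (sym (lookup-index f∈gs)))
                         (gateParities-act ℓ+k≡n C f (conserves (gen f∈gs)) i))
            (InSpan-generator generatorParities (index f∈gs))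
        parities∈span (comp {f = f} {g} ⌈f⌉ ⌈g⌉) ℓ+k≡n C@(e , _) =
          InSpan-resp generatorParities
            (λ i → sym (trans
              (parity-cong (class i) (tournament i) λ p →
                cong (λ (x , y) → from e (to f x , y)) (sym (strictlyInverseˡ e _)))
              (parity-∘ (class i) (isTournament i) (act C f) (act C g)
                (class-cong i ∘ act-conserves C g (conserves ⌈g⌉)))))
            (InSpan-xor generatorParities
              (parities∈span ⌈f⌉ ℓ+k≡n C) (parities∈span ⌈g⌉ ℓ+k≡n C))
        parities∈span (extend {ℓ} {f = f} ⌈f⌉ k α) ℓ+k+k′≡n C =
          InSpan-resp generatorParities
            (λ i → parity-cong (class i) (tournament i) (act-refine α C f))
            (parities∈span ⌈f⌉ (trans (sym (+-assoc ℓ k _)) ℓ+k+k′≡n) (refine α C))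
        parities∈span (resp f≗g ⌈f⌉) ℓ+k≡n C@(e , _) =
          InSpan-resp generatorParities
            (λ i → parity-cong (class i) (tournament i) λ p →
              cong (λ x → from e (x , proj₂ (to e p))) (f≗g _))
            (parities∈span ⌈f⌉ ℓ+k≡n C)

        -- Realising every parity vector

        exchange : Bool → Fin m → Permutation′ #Aⁿ
        exchange b i = if b then transpose (x₁ i) (x₂ i) else ↔-id _

        exchange-conserves : ∀ b i p → ∣ exchange b i ⟨$⟩ʳ p ∣ ≈ ∣ p ∣
        exchange-conserves false i p = ≈-refl
        exchange-conserves true  i p with p ≟ x₁ i
        ... | yes refl = ≈-trans (∣x₂∣ i) (≈-sym (∣x₁∣ i))
        ... | no _ with p ≟ x₂ i
        ...   | yes refl = ≈-trans (∣x₁∣ i) (≈-sym (∣x₂∣ i))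
        ...   | no _     = ≈-refl

        parities-exchange : ∀ b i → parities (to (exchange b i)) i ≡ b
        parities-exchange false i = parity-fixed (class i) (tournament i) λ _ _ → refl
        parities-exchange true  i = parity-transpose (x₁ i) (x₂ i) (class i) (x₁≢x₂ i)
          (dec-true (∣ x₁ i ∣≈? i) (∣x₁∣ i)) (dec-true (∣ x₂ i ∣≈? i) (∣x₂∣ i))

        -- Distinct classes are disjoint as `w` is injective, so an exchange in class `j` fixes
        -- class `i` pointwise.
        parities-exchange-≢ : ∀ b {i j} → j ≢ i → parities (to (exchange b j)) i ≡ false
        parities-exchange-≢ false {i} j≢i = parity-fixed (class i) (tournament i) λ _ _ → refl
        parities-exchange-≢ true {i} {j} j≢i =
          parity-fixed (class i) (tournament i) λ p p∈i →
            transpose-fixed (x₁ j) (x₂ j) (avoids p p∈i (∣x₁∣ j)) (avoids p p∈i (∣x₂∣ j))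
          where
          avoids : ∀ p → class i p ≡ true → ∀ {q} → ∣ q ∣ ≈ w j → p ≢ q
          avoids p p∈i q≈ refl = j≢i (w-injective (≈-trans (≈-sym q≈) (does⁻¹ (∣ p ∣≈? i) p∈i)))

      -- The product of the exchanges prescribed by `u` is conservative, hence generated by `gs`
      -- under the supposed equality, and its parity vector is `u`.
      ∃-spanning : ∃[ V ] ∀ u → InSpan {List.length gs} {m} V u
      ∃-spanning = generatorParities , λ u →
        InSpan-resp generatorParities (parities≡u u)
          (parities∈span {f = f u} (proj₂ gs≐Cons (f-conserves u)) (+-identityʳ n) C)
        where
        -- No wires are set aside, so a gate on `n` wires acts as itself, up to the enumeration of
        -- words.
        C : Cut n 0
        C = mk↔ₛ′ (_, []) proj₁ (λ { (x , []) → refl }) (λ _ → refl) ↔-∘ word ,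
            λ p → ≈-trans (∙-congˡ ε-homo) (∙-identityʳ ∣ p ∣)

        module _ (u : Fin m → Bool) where
          τ : Fin m → Permutation′ #Aⁿ
          τ j = exchange (u j) j

          τ-conserves : ∀ j p → ∣ τ j ⟨$⟩ʳ p ∣ ≈ ∣ p ∣
          τ-conserves j = exchange-conserves (u j) j

          ρ : Permutation′ #Aⁿ
          ρ = compose τ

          f : Sym (Vec A n)
          f = word ↔-∘ (ρ ↔-∘ ↔-sym word)

          f-conserves : Conserves f
          f-conserves x = ≈-trans
            (compose-respects {_∼_ = λ p q → ∣ p ∣ ≈ ∣ q ∣} ≈-refl ≈-trans τ τ-conserves (from word x))
            (≈-reflexive (cong weight (strictlyInverseˡ word x)))

          parities≡u : ∀ i → parities (to (act C f)) i ≡ u i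
          parities≡u i = begin
            parities (to (act C f)) i
              ≡⟨ parity-cong (class i) (tournament i) (λ p →
                   trans (strictlyInverseʳ word _) (cong (to ρ) (strictlyInverseʳ word p))) ⟩
            parities (to ρ) i
              ≡⟨ parity-compose (class i) (isTournament i) τ (λ j p → class-cong i (τ-conserves j p)) ⟩
            (∑[ j < m ] parities (to (τ j)) i)
              ≡⟨ sum-single i (λ j j≢i → parities-exchange-≢ (u j) j≢i) ⟩
            parities (to (τ i)) i
              ≡⟨ parities-exchange (u i) i ⟩
            u i ∎
            where open ≡-Reasoning

theorem28 : ∀ {a c ℓ} {A : Set a} {k} → A ↔ Fin k →
    (M : CommutativeMonoid c ℓ) (φ : List A → CommutativeMonoid.Carrier M) →
    IsMonoidHomomorphism (++-[]-rawMonoid A) (CommutativeMonoid.rawMonoid M) φ →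
    InfiniteDimensional M φ →
    ¬ FinitelyGenerated (Cons M φ)
-- One class for each of the `2 ^ D` combinations of `D` vectors, where `D` is the number of
-- generators, as the diagonal argument requires.
theorem28 A↔Fin M φ φ-hom infDim (gs , gs≐Cons) with infDim (2 ^ List.length gs)
-- Gates have positive arity, so length zero is excluded separately: there is only one empty word,
-- while at least one class exists because a power of two is positive. Its index is written as the
-- code of the zero function.
... | zero , w , w-injective , more with more (funToFin {List.length gs} {2} (λ _ → zero))
...   | [] , [] , []≢[] , _ = []≢[] refl
theorem28 A↔Fin M φ φ-hom infDim (gs , gs≐Cons) | suc n , w , w-injective , more =
  -- Double negation commutes with quantification over a finite set, so excluded middle is available
  -- for all words `p` and classes `i` simultaneously.
  (sequence ¬¬-applicative λ p → sequence ¬¬-applicative λ i → ¬¬-excluded-middle) λ decide →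
    let V , V-spans = ∃-spanning M φ φ-hom A↔Fin gs≐Cons w w-injective more decide
        u , u∉span  = ∃-outside-span V
    in u∉span (V-spans u)
  where ¬¬-applicative = RawMonad.rawApplicative ¬¬-Monad
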